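{- There exists a family of broadcast protocols $(P_n)_{n}$, $P_n=(Q_n,I_n,M_n,\Delta_n)$, with target sets $F_n\subseteq Q_n$ and $|Q_n|\in O(n)$, such that for every $n$ there exist both a reconfigurable execution and a lossy execution of $P_n$ covering $F_n$, and every reconfigurable or lossy execution of $P_n$ covering $F_n$ has $\Omega(n)$ nodes and length $\Omega(n^2)$.
   Context: A broadcast protocol is a tuple $P=(Q,I,M,\Delta)$ where $Q$ is a finite set of states, $I\subseteq Q$ initial states, $M$ a finite message alphabet and $\Delta\subseteq Q\times\{!!m,\ ??m \mid m\in M\}\times Q$ ($!!m$ = broadcast, $??m$ = reception); protocols are complete for receptions (for every $q$, $m$ there is $q'$ with $(q,??m,q')\in\Delta$). A configuration is a finite undirected graph $\gamma=(V,E,L)$, $E$ symmetric irreflexive, $L:V\to Q$; initial if $L(V)\subseteq I$. A reconfigurable step from $(V,E,L)$ to $(V,E',L')$ ($E'$ arbitrary): some node $v$ and $m$ with $(L(v),!!m,L'(v))\in\Delta$, every neighbour $v'$ of $v$ in $E$ satisfies $(L(v'),??m,L'(v'))\in\Delta$, every other node keeps its label. A lossy step from $(V,E,L)$ to $(V,E,L')$ (edges fixed): some $v$, $m$ with $(L(v),!!m,L'(v))\in\Delta$ and either all other nodes keep their labels (lost broadcast) or as in the reconfigurable step with $E$ (successful broadcast). A reconfigurable (resp. lossy) execution is a sequence $\gamma_0,\dots,\gamma_r$ with $\gamma_0$ initial and consecutive reconfigurable (resp. lossy) steps; its number of nodes is $|V|$, its length is $r$, and it covers $F$ if some node of $\gamma_r$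 has a label in $F$. -}

module Defs where

open import Data.Fin using (Fin; zero; suc; inject₁; fromℕ)
open import Data.Fin.Subset using (Subset; _∈_)
open import Data.Nat using (ℕ; suc; _*_; _≤_; _≥_)
open import Data.Product using (∃-syntax; _×_)
open import Data.Sum using (_⊎_)
open import Level using (Level; 0ℓ)
open import Relation.Binary using (Rel; Decidable; Symmetric; Irreflexive; _⇔_)
open import Relation.Binary.PropositionalEquality using (_≡_; _≢_)
open import Relation.Nullary using (¬_)

data Action (M : Set) : Set where
  !!_ ??_ : M → Action M

-- Subsets of finite sets are decidable throughout, as they are classically.
record Protocol : Set₁ where
  field
    ∣Q∣ ∣M∣ : ℕ

  Q : Set
  Q = Fin ∣Q∣

  M : Set
  M = Fin ∣M∣

  field
    I        : Subset ∣Q∣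
    Δ        : Q → Action M → Q → Set
    Δ?       : ∀ a → Decidable (λ q q′ → Δ q a q′)
    complete : ∀ q m → ∃[ q′ ] Δ q (?? m) q′

open Protocol public

-- Configurations whose node set V is Fin k.
record Configuration (P : Protocol) (k : ℕ) : Set₁ where
  field
    E        : Rel (Fin k) 0ℓ
    E?       : Decidable E
    E-sym    : Symmetric E
    E-irrefl : Irreflexive _≡_ E
    L        : Fin k → Q P

open Configuration public

module _ {P : Protocol} {k : ℕ} where

  Initial : Configuration P k → Set
  Initial γ = ∀ v → L γ v ∈ I P

  Broadcasts : Configuration P k → Configuration P k → Fin k → M P → Set
  Broadcasts γ γ′ v m = Δ P (L γ v) (!! m) (L γ′ v)

  -- Receivers are determined by the edges of the source configuration.
  Received : Configuration P k → Configuration P k → Fin k → M P → Set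
  Received γ γ′ v m =
    (∀ u → E γ v u → Δ P (L γ u) (?? m) (L γ′ u)) ×
    (∀ u → u ≢ v → ¬ E γ v u → L γ′ u ≡ L γ u)

  Lost : Configuration P k → Configuration P k → Fin k → Set
  Lost γ γ′ v = ∀ u → u ≢ v → L γ′ u ≡ L γ u

  ReconfigurableStep : Configuration P k → Configuration P k → Set
  ReconfigurableStep γ γ′ =
    ∃[ v ] ∃[ m ] Broadcasts γ γ′ v m × Received γ γ′ v m

  LossyStep : Configuration P k → Configuration P k → Set
  LossyStep γ γ′ = (E γ ⇔ E γ′) ×
    (∃[ v ] ∃[ m ] Broadcasts γ γ′ v m × (Lost γ γ′ v ⊎ Received γ γ′ v m))

data Semantics : Set where
  reconfigurable lossy : Semantics

Step : Semantics → ∀ {P k} → Configuration P k → Configuration P k → Set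
Step reconfigurable = ReconfigurableStep
Step lossy          = LossyStep

record Execution (s : Semantics) (P : Protocol) : Set₁ where
  field
    nodes   : ℕ
    len     : ℕ
    γ       : Fin (suc len) → Configuration P nodes
    initial : Initial (γ zero)
    steps   : ∀ (i : Fin len) → Step s (γ (inject₁ i)) (γ (suc i))

open Execution public

Covers : ∀ {s P} → Execution s P → Subset (∣Q∣ P) → Set
Covers ρ F = ∃[ v ] L (γ ρ (fromℕ (len ρ))) v ∈ F

record CoveringExecution (P : Protocol) (F : Subset (∣Q∣ P)) : Set₁ where
  field
    semantics : Semantics
    execution : Execution semantics P
    covers    : Covers execution F

open CoveringExecution public

_∈O_ : (ℕ → ℕ) → (ℕ → ℕ) → Set
f ∈O g = ∃[ c ] ∃[ n₀ ] ∀ n → n ≥ n₀ → f n ≤ c * g n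

-- A size measure on a family of types is Ω(g) when one constant serves all
-- inhabitants. The multiplier c is the inverse of the usual constant; c = 0
-- is useless wherever g is positive.
_∈Ω_ : ∀ {a : Level} {X : ℕ → Set a} → (∀ n → X n → ℕ) → (ℕ → ℕ) → Set a
_∈Ω_ {X = X} f g = ∃[ c ] ∃[ n₀ ] ∀ n → n ≥ n₀ → (x : X n) → g n ≤ c * f n x

{-# OPTIONS --safe #-}

-- The states of Pₙ form one chain 0, …, 2n+1. A node climbs from 0 to n by n
-- private broadcasts, announces itself by a message "done" that takes it to
-- n+1, and from then on may climb only by receiving "done". A node at position
-- x > n has therefore seen at least x − n announcements, its own included. Each
-- node announces at most once, so the top state requires n+1 nodes to have
-- climbed past n, each of them by n+1 broadcasts of its own.
module Submission where

open import Algebra.Properties.CommutativeSemigroup using (x∙yz≈y∙xz)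
open import Algebra.Properties.Semiring.Sum using (sum; *-distribˡ-sum)
open import Data.Fin as Fin using (Fin; zero; suc; toℕ; fromℕ; fromℕ<; inject₁)
open import Data.Fin.Induction using (<-weakInduction)
open import Data.Fin.Patterns using (0F; 1F)
open import Data.Fin.Properties
  using (toℕ-fromℕ; toℕ-fromℕ<; toℕ-inject₁; toℕ-injective)
open import Data.Fin.Subset using (Subset; _∈_; ⁅_⁆)
open import Data.Fin.Subset.Properties using (x∈⁅x⁆; x∈⁅y⁆⇒x≡y)
open import Data.Nat using (ℕ; zero; suc; _+_; _*_; _∸_; _⊓_; _^_; _≤_; _<_; _≟_; _<?_; z≤n; s≤s)
open import Data.Nat.Properties hiding (_≟_; _<?_)
open import Data.Product using (∃-syntax; Σ-syntax; _×_; _,_; proj₁; proj₂)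
open import Data.Sum using (_⊎_; inj₁; inj₂)
open import Data.Vec.Functional using (Vector; updateAt)
open import Data.Vec.Functional.Properties using (updateAt-updates; updateAt-minimal)
open import Function using (const; _∘_; id)
open import Level using (0ℓ)
open import Relation.Binary using (Rel)
open import Relation.Binary.Construct.Closure.ReflexiveTransitive using (Star; ε; _◅_; _◅◅_; gmap)
open import Relation.Binary.PropositionalEquality
open import Relation.Nullary using (yes; no; contradiction)
open import Relation.Nullary.Decidable using (_×-dec_; _⊎-dec_; ¬?)
open import Defs

-- Sums of natural numbers over the nodes.

private
  Σℕ : ∀ {k} → Vector ℕ k → ℕ
  Σℕ = sum +-*-semiring

Σ-mono : ∀ {k} {f g : Vector ℕ k} → (∀ i → f i ≤ g i) → Σℕ f ≤ Σℕ g
Σ-mono {zero}  f≤g = z≤n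
Σ-mono {suc k} f≤g = +-mono-≤ (f≤g zero) (Σ-mono (f≤g ∘ suc))

Σ-≤-size : ∀ {k} {f : Vector ℕ k} → (∀ i → f i ≤ 1) → Σℕ f ≤ k
Σ-≤-size {zero}  f≤1 = z≤n
Σ-≤-size {suc k} f≤1 = +-mono-≤ (f≤1 zero) (Σ-≤-size (f≤1 ∘ suc))

Σ-zero : ∀ {k} {f : Vector ℕ k} → (∀ i → f i ≡ 0) → Σℕ f ≡ 0
Σ-zero {zero}  f≡0 = refl
Σ-zero {suc k} f≡0 = cong₂ _+_ (f≡0 zero) (Σ-zero (f≡0 ∘ suc))

-- A step singles out its sender `v`. The slacks `c` and `d` let one proof serve a total that grows
-- by at most one (`0`, `1`), grows by at least one (`1`, `0`) or does not shrink (`0`, `0`).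
Σ-mono-at : ∀ {k} {f g : Vector ℕ k} (v : Fin k) c d → c + f v ≤ d + g v →
            (∀ u → u ≢ v → f u ≤ g u) → c + Σℕ f ≤ d + Σℕ g
Σ-mono-at {suc k} {f} {g} zero c d p f≤g = begin
  c + (f zero + Σℕ (f ∘ suc)) ≡⟨ +-assoc c _ _ ⟨
  c + f zero + Σℕ (f ∘ suc)   ≤⟨ +-mono-≤ p (Σ-mono λ i → f≤g (suc i) λ ()) ⟩
  d + g zero + Σℕ (g ∘ suc)   ≡⟨ +-assoc d _ _ ⟩
  d + (g zero + Σℕ (g ∘ suc)) ∎
  where open ≤-Reasoning
Σ-mono-at {suc k} {f} {g} (suc v) c d p f≤g = begin
  c + (f zero + Σℕ (f ∘ suc)) ≡⟨ x∙yz≈y∙xz +-commutativeSemigroup c (f zero) _ ⟩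
  f zero + (c + Σℕ (f ∘ suc)) ≤⟨ +-mono-≤ (f≤g zero λ ())
                                   (Σ-mono-at v c d p λ u u≢v → f≤g (suc u) λ { refl → u≢v refl }) ⟩
  g zero + (d + Σℕ (g ∘ suc)) ≡⟨ x∙yz≈y∙xz +-commutativeSemigroup (g zero) d _ ⟩
  d + (g zero + Σℕ (g ∘ suc)) ∎
  where open ≤-Reasoning

-- From paths to executions.

module _ {s : Semantics} {P : Protocol} {k : ℕ} where

  private
    length : {γ γ′ : Configuration P k} → Star (Step s) γ γ′ → ℕ
    length ε        = 0
    length (_ ◅ xs) = suc (length xs)

    at : ∀ {γ γ′} (xs : Star (Step s) γ γ′) → Fin (suc (length xs)) → Configuration P k
    at {γ} xs       zero    = γ
    at     (_ ◅ xs) (suc i) = at xs i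

    at-last : ∀ {γ γ′} (xs : Star (Step s) γ γ′) → at xs (fromℕ (length xs)) ≡ γ′
    at-last ε        = refl
    at-last (_ ◅ xs) = at-last xs

    at-steps : ∀ {γ γ′} (xs : Star (Step s) γ γ′) (i : Fin (length xs)) →
               Step s (at xs (inject₁ i)) (at xs (suc i))
    at-steps (x ◅ xs) zero    = x
    at-steps (x ◅ xs) (suc i) = at-steps xs i

  -- Paths are assembled by concatenation in `Star`; the indexed form that `Execution` demands is
  -- produced only here.
  covering-execution : ∀ {γ γ′ F} → Initial γ → Star (Step s) γ γ′ → ∀ v → L γ′ v ∈ F →
                       Σ[ ρ ∈ Execution s P ] Covers ρ F
  covering-execution {F = F} init xs v v∈F =
    record { nodes = k ; len = length xs ; γ = at xs ; initial = init ; steps = at-steps xs } ,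
    v , subst (λ γ → L γ v ∈ F) (sym (at-last xs)) v∈F

-- Both semantics reduced to a dynamics of labels.

-- When every reception may be ignored, a step of either semantics is, on the
-- labels, a broadcast that each other node may or may not take into account.
Fires : (P : Protocol) {k : ℕ} → Rel (Fin k → Q P) 0ℓ
Fires P ℓ ℓ′ = ∃[ v ] ∃[ m ] Δ P (ℓ v) (!! m) (ℓ′ v) ×
               (∀ u → u ≢ v → Δ P (ℓ u) (?? m) (ℓ′ u))

module _ {P : Protocol} (ignore : ∀ q m → Δ P q (?? m) q) {k : ℕ} where

  private
    lost⇒ : ∀ (γ γ′ : Configuration P k) v m → Lost γ γ′ v →
            ∀ u → u ≢ v → Δ P (L γ u) (?? m) (L γ′ u)
    lost⇒ γ γ′ v m lost u u≢v rewrite lost u u≢v = ignore _ m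

    received⇒ : ∀ (γ γ′ : Configuration P k) v m → Received γ γ′ v m →
                ∀ u → u ≢ v → Δ P (L γ u) (?? m) (L γ′ u)
    received⇒ γ γ′ v m (adj , nonadj) u u≢v with E? γ v u
    ... | yes e = adj u e
    ... | no ¬e rewrite nonadj u u≢v ¬e = ignore _ m

  step⇒fires : ∀ s (γ γ′ : Configuration P k) → Step s γ γ′ → Fires P (L γ) (L γ′)
  step⇒fires reconfigurable γ γ′ (v , m , b , r)          = v , m , b , received⇒ γ γ′ v m r
  step⇒fires lossy          γ γ′ (_ , v , m , b , inj₁ l) = v , m , b , lost⇒ γ γ′ v m l
  step⇒fires lossy          γ γ′ (_ , v , m , b , inj₂ r) = v , m , b , received⇒ γ γ′ v m r

module _ {P : Protocol} {k : ℕ} where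

  -- With every two nodes adjacent, all nodes but the sender are receivers, so a successful
  -- broadcast realises any choice of receptions in `Fires`. The edges never change, which makes the
  -- same step valid in both semantics.
  complete-graph : (Fin k → Q P) → Configuration P k
  complete-graph ℓ = record
    { E        = _≢_
    ; E?       = λ u v → ¬? (u Fin.≟ v)
    ; E-sym    = ≢-sym
    ; E-irrefl = λ u≡v u≢v → u≢v u≡v
    ; L        = ℓ
    }

  fires⇒step : ∀ s {ℓ ℓ′} → Fires P ℓ ℓ′ → Step s (complete-graph ℓ) (complete-graph ℓ′)
  fires⇒step s {ℓ} {ℓ′} (v , m , b , r) = go s
    where
    received : Received (complete-graph ℓ) (complete-graph ℓ′) v m
    received = (λ u v≢u → r u (≢-sym v≢u)) , (λ u u≢v ¬v≢u → contradiction (≢-sym u≢v) ¬v≢u)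

    go : ∀ s → Step s (complete-graph ℓ) (complete-graph ℓ′)
    go reconfigurable = v , m , b , received
    go lossy          = (id , id) , v , m , b , inj₂ received

  -- `ℓ′` prescribes the receivers only: its entry at `v` is overwritten by `q`.
  fire : ∀ (ℓ ℓ′ : Fin k → Q P) v m {q} → Δ P (ℓ v) (!! m) q →
         (∀ u → u ≢ v → Δ P (ℓ u) (?? m) (ℓ′ u)) → Fires P ℓ (updateAt ℓ′ v (const q))
  fire ℓ ℓ′ v m {q} b r =
    v , m , subst (Δ P (ℓ v) (!! m)) (sym (updateAt-updates v ℓ′)) b ,
    λ u u≢v → subst (Δ P (ℓ u) (?? m)) (sym (updateAt-minimal u v ℓ′ u≢v)) (r u u≢v)

-- The chain protocol and its measures.

module _ (n : ℕ) where

  private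
    pattern climb = 0F
    pattern done  = 1F

    State : Set
    State = Fin (suc (n + suc n))

    Next : State → State → Set
    Next q q′ = toℕ q′ ≡ suc (toℕ q)

  -- Every reception may leave the state unchanged, so a missed message counts as a received one.
  -- The guard `n < toℕ q` makes the passage from `n` to `n+1` possible only by a node's own
  -- announcement.
  Move : State → Action (Fin 2) → State → Set
  Move q (!! climb) q′ = toℕ q < n × Next q q′
  Move q (!! done)  q′ = toℕ q ≡ n × Next q q′
  Move q (?? climb) q′ = q′ ≡ q
  Move q (?? done)  q′ = q′ ≡ q ⊎ (n < toℕ q × Next q q′)

  stay : ∀ q m → Move q (?? m) q
  stay q climb = refl
  stay q done  = inj₁ refl

  chain : Protocol
  chain = record
    { ∣Q∣      = suc (n + suc n)
    ; ∣M∣      = 2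
    ; I        = ⁅ zero ⁆
    ; Δ        = Move
    ; Δ?       = move?
    ; complete = λ q m → q , stay q m
    }
    where
    next? : ∀ q q′ → _
    next? q q′ = toℕ q′ ≟ suc (toℕ q)

    move? : ∀ a q q′ → _
    move? (!! climb) q q′ = (toℕ q <? n) ×-dec next? q q′
    move? (!! done)  q q′ = (toℕ q ≟ n) ×-dec next? q q′
    move? (?? climb) q q′ = q′ Fin.≟ q
    move? (?? done)  q q′ = (q′ Fin.≟ q) ⊎-dec ((n <? toℕ q) ×-dec next? q q′)

  top : Subset (suc (n + suc n))
  top = ⁅ fromℕ (n + suc n) ⁆

  -- `effort` is the number of broadcasts that a node at position `x` has made itself: up to `n`
  -- climbs and one announcement, whence the cap. `announced` is the indicator of `n < x`, in
  -- truncated arithmetic so that monotonicity comes for free.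
  effort announced : ℕ → ℕ
  effort    x = x ⊓ suc n
  announced x = (x ∸ n) ⊓ 1

  effort-suc : ∀ x → effort (suc x) ≤ suc (effort x)
  effort-suc x = s≤s (⊓-monoʳ-≤ x (n≤1+n n))

  effort-stable : ∀ {x} → n < x → effort (suc x) ≡ effort x
  effort-stable n<x = trans (m≥n⇒m⊓n≡n (m≤n⇒m≤1+n n<x)) (sym (m≥n⇒m⊓n≡n n<x))

  announced-mono : ∀ {x y} → x ≤ y → announced x ≤ announced y
  announced-mono x≤y = ⊓-monoˡ-≤ 1 (∸-monoˡ-≤ n x≤y)

  announced-done : announced (suc n) ≡ suc (announced n)
  announced-done rewrite n∸n≡0 n | m+n∸n≡m 1 n = refl

  -- This converts a count of announcing nodes into a count of broadcasts. Past `n` the cap of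
  -- `effort` is attained; up to `n` the left side vanishes.
  announced≤effort : ∀ x → suc n * announced x ≤ effort x
  announced≤effort x with n <? x
  ... | yes n<x = begin
    suc n * announced x ≤⟨ *-monoʳ-≤ (suc n) (m⊓n≤n (x ∸ n) 1) ⟩
    suc n * 1           ≡⟨ *-identityʳ (suc n) ⟩
    suc n               ≡⟨ m≥n⇒m⊓n≡n n<x ⟨
    effort x            ∎
    where open ≤-Reasoning
  ... | no n≮x rewrite m≤n⇒m∸n≡0 (≮⇒≥ n≮x) | *-zeroʳ n = z≤n

  -- The invariant and the lower bounds.

  module _ {k : ℕ} where

    Σeffort Σannounced : (Fin k → State) → ℕ
    Σeffort    ℓ = Σℕ λ v → effort (toℕ (ℓ v))
    Σannounced ℓ = Σℕ λ v → announced (toℕ (ℓ v))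

    -- The invariant after `t` steps: time pays for effort, and announcements pay for every position
    -- beyond `n`.
    Bounded : ℕ → (Fin k → State) → Set
    Bounded t ℓ = Σeffort ℓ ≤ t × (∀ u → toℕ (ℓ u) ∸ n ≤ Σannounced ℓ)

    private
      broadcast-next : ∀ {q q′} m → Move q (!! m) q′ → Next q q′
      broadcast-next climb = proj₂
      broadcast-next done  = proj₂

      -- A reception moves only nodes past `n`, where `effort` is already at its cap.
      receive-effort : ∀ {q q′} m → Move q (?? m) q′ → effort (toℕ q′) ≤ effort (toℕ q)
      receive-effort climb refl                 = ≤-refl
      receive-effort done  (inj₁ refl)          = ≤-refl
      receive-effort done  (inj₂ (n<q , q′≡1+q)) rewrite q′≡1+q = ≤-reflexive (effort-stable n<q)

      receive-≤ : ∀ {q q′} m → Move q (?? m) q′ → toℕ q ≤ toℕ q′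
      receive-≤ climb refl                = ≤-refl
      receive-≤ done  (inj₁ refl)         = ≤-refl
      receive-≤ done  (inj₂ (_ , q′≡1+q)) rewrite q′≡1+q = n≤1+n _

      receive-done-∸ : ∀ {q q′} → Move q (?? done) q′ → toℕ q′ ∸ n ≤ suc (toℕ q ∸ n)
      receive-done-∸ (inj₁ refl) = n≤1+n _
      receive-done-∸ {q} (inj₂ (n<q , q′≡1+q)) rewrite q′≡1+q =
        ≤-reflexive (+-∸-assoc 1 (<⇒≤ n<q))

    -- Only the sender can gain effort, and at most one unit. A `climb` leaves its sender at or
    -- below `n` and all others in place. A `done` lifts each receiver by at most one, and the
    -- sender's crossing raises `Σannounced` by one to match.
    fires-bounded : ∀ {t} (ℓ ℓ′ : Fin k → State) → Fires chain ℓ ℓ′ →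
                    Bounded t ℓ → Bounded (suc t) ℓ′
    fires-bounded ℓ ℓ′ (v , m , b , r) (effort≤t , seen) =
      ≤-trans (Σ-mono-at v 0 1 effort-v λ u u≢v → receive-effort m (r u u≢v)) (s≤s effort≤t) ,
      seen′ m b r
      where
      v-next : Next (ℓ v) (ℓ′ v)
      v-next = broadcast-next m b

      effort-v : effort (toℕ (ℓ′ v)) ≤ suc (effort (toℕ (ℓ v)))
      effort-v rewrite v-next = effort-suc _

      v-≤ : toℕ (ℓ v) ≤ toℕ (ℓ′ v)
      v-≤ rewrite v-next = n≤1+n _

      announced-others : ∀ u → u ≢ v → announced (toℕ (ℓ u)) ≤ announced (toℕ (ℓ′ u))
      announced-others u u≢v = announced-mono (receive-≤ m (r u u≢v))

      seen′ : ∀ m → Move (ℓ v) (!! m) (ℓ′ v) →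
              (∀ u → u ≢ v → Move (ℓ u) (?? m) (ℓ′ u)) →
              ∀ u → toℕ (ℓ′ u) ∸ n ≤ Σannounced ℓ′
      seen′ climb (v<n , _) stays u with u Fin.≟ v
      ... | yes refl rewrite v-next | m≤n⇒m∸n≡0 v<n = z≤n
      ... | no u≢v rewrite stays u u≢v =
        ≤-trans (seen u) (Σ-mono-at v 0 0 (announced-mono v-≤) announced-others)
      seen′ done (v≡n , _) receives u = ≤-trans (bound u) more
        where
        announces : suc (announced (toℕ (ℓ v))) ≤ announced (toℕ (ℓ′ v))
        announces rewrite v-next | v≡n = ≤-reflexive (sym announced-done)

        more : suc (Σannounced ℓ) ≤ Σannounced ℓ′
        more = Σ-mono-at v 1 0 announces announced-others

        bound : ∀ u → toℕ (ℓ′ u) ∸ n ≤ suc (Σannounced ℓ)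
        bound u with u Fin.≟ v
        -- The sender lands on `n+1`; its excess of one is its own announcement.
        ... | yes refl rewrite v-next | v≡n | m+n∸n≡m 1 n = s≤s z≤n
        ... | no u≢v = ≤-trans (receive-done-∸ (receives u u≢v)) (s≤s (seen u))

    zero-bounded : ∀ (ℓ : Fin k → State) → (∀ v → ℓ v ≡ zero) → Bounded 0 ℓ
    zero-bounded ℓ ℓ≡0 =
      ≤-reflexive (Σ-zero λ v → cong (effort ∘ toℕ) (ℓ≡0 v)) ,
      λ u → ≤-trans (≤-reflexive (trans (cong (λ q → toℕ q ∸ n) (ℓ≡0 u)) (0∸n≡0 n))) z≤n

    -- The top exceeds `n` by `n+1`, so the invariant yields `n+1` announcements. At one per node
    -- they bound `k`; at `n+1` units of effort each they bound `t`.
    covered-bounds : ∀ {t} (ℓ : Fin k → State) → Bounded t ℓ → ∀ v → ℓ v ∈ top →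
                     suc n ≤ k × suc n * suc n ≤ t
    covered-bounds {t} ℓ (effort≤t , seen) v v∈top =
      ≤-trans many (Σ-≤-size λ u → m⊓n≤n (toℕ (ℓ u) ∸ n) 1) ,
      (begin
        suc n * suc n                                 ≤⟨ *-monoʳ-≤ (suc n) many ⟩
        suc n * Σannounced ℓ                          ≡⟨ *-distribˡ-sum +-*-semiring (suc n) (announced ∘ toℕ ∘ ℓ) ⟩
        (Σℕ λ u → suc n * announced (toℕ (ℓ u)))      ≤⟨ Σ-mono (λ u → announced≤effort (toℕ (ℓ u))) ⟩
        Σeffort ℓ                                     ≤⟨ effort≤t ⟩
        t                                             ∎)
      where
      open ≤-Reasoning
      many : suc n ≤ Σannounced ℓ
      many = begin
        suc n                               ≡⟨ m+n∸m≡n n (suc n) ⟨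
        n + suc n ∸ n                       ≡⟨ cong (_∸ n) (toℕ-fromℕ (n + suc n)) ⟨
        toℕ (fromℕ (n + suc n)) ∸ n         ≡⟨ cong (λ q → toℕ q ∸ n) (x∈⁅y⁆⇒x≡y (fromℕ (n + suc n)) v∈top) ⟨
        toℕ (ℓ v) ∸ n                       ≤⟨ seen v ⟩
        Σannounced ℓ                        ∎

  execution-bounded : ∀ {s} (ρ : Execution s chain) (i : Fin (suc (len ρ))) →
                      Bounded (toℕ i) (L (γ ρ i))
  execution-bounded {s} ρ = <-weakInduction (λ i → Bounded (toℕ i) (L (γ ρ i)))
    (zero-bounded (L (γ ρ zero)) λ v → x∈⁅y⁆⇒x≡y zero (initial ρ v))
    λ i h → fires-bounded (L (γ ρ (inject₁ i))) (L (γ ρ (suc i)))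
              (step⇒fires stay s (γ ρ (inject₁ i)) (γ ρ (suc i)) (steps ρ i))
              (subst (λ t → Bounded t (L (γ ρ (inject₁ i)))) (toℕ-inject₁ i) h)

  covering-bounds : (x : CoveringExecution chain top) →
                    suc n ≤ nodes (execution x) × suc n * suc n ≤ len (execution x)
  covering-bounds x =
    covered-bounds ℓ (subst (λ t → Bounded t ℓ) (toℕ-fromℕ (len ρ)) (execution-bounded ρ last))
                   (proj₁ (covers x)) (proj₂ (covers x))
    where
    ρ    = execution x
    last = fromℕ (len ρ)
    ℓ    = L (γ ρ last)

  -- A covering execution on `n+1` nodes.

  private
    Labelling : Set
    Labelling = Fin (suc n) → State

    _⟶*_ : Labelling → Labelling → Set
    _⟶*_ = Star (Fires chain)

    next : ∀ {q} → toℕ q < n + suc n → ∃[ q′ ] Next q q′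
    next q<top = fromℕ< (s≤s q<top) , toℕ-fromℕ< (s≤s q<top)

    n<top : n < n + suc n
    n<top = m<m+n n (s≤s z≤n)

  -- Receiving `climb` never changes a state, so one node can be raised alone even when all others
  -- hear it.
  climbs : ∀ (ℓ : Labelling) v → ℓ v ≡ zero → ∀ {i} → i ≤ n →
           ∃[ ℓ′ ] (ℓ ⟶* ℓ′) × toℕ (ℓ′ v) ≡ i × (∀ u → u ≢ v → ℓ′ u ≡ ℓ u)
  climbs ℓ v v≡0 {zero}  _   = ℓ , ε , cong toℕ v≡0 , λ _ _ → refl
  climbs ℓ v v≡0 {suc i} i<n =
    let ℓ′ , path , v≡i , same = climbs ℓ v v≡0 (<⇒≤ i<n)
        v<n       = subst (_< n) (sym v≡i) i<n
        q , q≡1+v = next (<-trans v<n n<top)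
    in updateAt ℓ′ v (const q) ,
       path ◅◅ fire {P = chain} ℓ′ ℓ′ v climb (v<n , q≡1+v) (λ _ _ → refl) ◅ ε ,
       trans (cong toℕ (updateAt-updates v ℓ′)) (trans q≡1+v (cong suc v≡i)) ,
       λ u u≢v → trans (updateAt-minimal u v ℓ′ u≢v) (same u u≢v)

  -- Node 0 announces first and then collects the announcements of nodes
  -- 1, …, j; the nodes beyond j are still unused.
  collects : ∀ j → j ≤ n →
             ∃[ ℓ ] (const zero ⟶* ℓ) × toℕ (ℓ zero) ≡ n + suc j × (∀ u → j < toℕ u → ℓ u ≡ zero)
  collects zero _ =
    let ℓ , path , 0≡n , same = climbs (const zero) zero refl ≤-refl
        q , q≡1+n = next (subst (_< n + suc n) (sym 0≡n) n<top)
    in updateAt ℓ zero (const q) ,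
       path ◅◅ fire {P = chain} ℓ ℓ zero done (0≡n , q≡1+n) (λ u _ → stay (ℓ u) done) ◅ ε ,
       trans q≡1+n (trans (cong suc 0≡n) (+-comm 1 n)) ,
       λ { (suc u) _ → same (suc u) λ () }
  collects (suc j) j<n =
    let ℓ₀ , path₀ , c≡ , unused = collects j (<⇒≤ j<n)
        v                    = Fin.suc (fromℕ< j<n)
        v≡                   = cong suc (toℕ-fromℕ< j<n)
        ℓ , path , v≡n , same = climbs ℓ₀ v (unused v (≤-reflexive (sym v≡))) ≤-refl
        0≡                   = trans (cong toℕ (same zero λ ())) c≡
        q , q≡               = next (subst (_< n + suc n) (sym v≡n) n<top)
        -- Node 0 stands at `n + suc j`, still below the top since `j < n`.
        c , c≡1+             = next (subst (_< n + suc n) (sym 0≡) (+-monoʳ-< n (s≤s j<n)))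
        n<0                  = subst (n <_) (sym 0≡) (m<m+n n (s≤s z≤n))
    -- Both updates belong to one step: `v` announces, node 0 takes the message into account and the
    -- rest ignore it.
    in updateAt (updateAt ℓ zero (const c)) v (const q) ,
       path₀ ◅◅ path ◅◅
         fire {P = chain} ℓ (updateAt ℓ zero (const c)) v done (v≡n , q≡) (λ { zero _ → inj₂ (n<0 , c≡1+) ; (suc u) _ → inj₁ refl }) ◅ ε ,
       trans c≡1+ (trans (cong suc 0≡) (sym (+-suc n (suc j)))) ,
       λ { (suc u) 1+j<u →
           let u≢v = λ u≡v → <-irrefl (trans (sym v≡) (cong toℕ (sym u≡v))) 1+j<u
           in trans (updateAt-minimal (suc u) v (updateAt ℓ zero (const c)) u≢v)
                    (trans (same (suc u) u≢v) (unused (suc u) (<-trans (n<1+n j) 1+j<u))) }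

  -- After the announcements of all `n` other nodes, node 0 stands at `n + suc n`, the last state.
  coverable : ∀ s → Σ[ ρ ∈ Execution s chain ] Covers ρ top
  coverable s =
    let ℓ , path , 0≡top , _ = collects n ≤-refl
    in covering-execution {γ = complete-graph (const zero)}
         (λ _ → x∈⁅x⁆ zero) (gmap complete-graph (fires⇒step s) path) zero
         (subst (_∈ top) (toℕ-injective (trans (toℕ-fromℕ _) (sym 0≡top))) (x∈⁅x⁆ _))

theorem3p8 : Σ[ P ∈ (ℕ → Protocol) ] Σ[ F ∈ ((n : ℕ) → Subset (∣Q∣ (P n))) ]
    ((λ n → ∣Q∣ (P n)) ∈O (λ n → n)) ×
    (∀ n → (Σ[ ρ ∈ Execution reconfigurable (P n) ] Covers ρ (F n)) ×
    (Σ[ ρ ∈ Execution lossy (P n) ] Covers ρ (F n))) ×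
    ((λ n (x : CoveringExecution (P n) (F n)) → nodes (execution x)) ∈Ω (λ n → n)) ×
    ((λ n (x : CoveringExecution (P n) (F n)) → len (execution x)) ∈Ω (λ n → n ^ 2))
-- There are `2n+2` states, at most `4n` once `n` is at least 1. The lower bounds hold with constant
-- 1 for all `n`.
theorem3p8 = chain , top , (4 , 1 , size) ,
  (λ n → coverable n reconfigurable , coverable n lossy) ,
  (1 , 0 , λ n _ x → ≤-trans (n≤1+n n)
    (≤-trans (proj₁ (covering-bounds n x)) (≤-reflexive (sym (*-identityˡ _))))) ,
  (1 , 0 , λ n _ x → ≤-trans (square n)
    (≤-trans (proj₂ (covering-bounds n x)) (≤-reflexive (sym (*-identityˡ _)))))
  where
  size : ∀ n → 1 ≤ n → suc (n + suc n) ≤ 4 * n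
  size n 1≤n = begin
    suc (n + suc n)     ≤⟨ +-mono-≤ 1≤n (+-monoʳ-≤ n (+-monoˡ-≤ n 1≤n)) ⟩
    n + (n + (n + n))   ≡⟨ cong (λ m → n + (n + (n + m))) (+-identityʳ n) ⟨
    4 * n               ∎
    where open ≤-Reasoning

  square : ∀ n → n ^ 2 ≤ suc n * suc n
  square n = *-mono-≤ (n≤1+n n) (≤-trans (≤-reflexive (*-identityʳ n)) (n≤1+n n))
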